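{- The family of substitutions $\bullet_\Gamma:\Sigma_r(\mathrm{D}\Gamma)\to\Gamma$, for $\Gamma$ ranging over contexts of $\mathsf{CaTT}$, defines a natural transformation $\Sigma_r\circ\mathrm{D}\Rightarrow\mathrm{id}_{\mathrm{Syn}(\mathsf{CaTT})}$.
   Context: $\mathsf{CaTT}$ is the Finster–Mimram type theory for weak $\omega$-categories (types $\star$, $\mathrm{Hom}_Atu$; terms variables, $\mathsf{op}$, $\mathsf{coh}$ indexed by ps-contexts). $\mathsf{MCaTT}$ is the type theory with a unit type $\mathbb{1}$ (constant $()$, $\eta$-rule), types $\mathrm{Hom}_Atu$ and term constructors $\mathsf{mop}$, $\mathsf{mcoh}$. $\mathrm{Syn}(T)$ is the syntactic category. The desuspension functor $\mathrm{D}:\mathrm{Syn}(\mathsf{CaTT})\to\mathrm{Syn}(\mathsf{MCaTT})$ replaces $\star$ by $\mathbb{1}$, $\mathsf{op}$ by $\mathsf{mop}$, $\mathsf{coh}$ by $\mathsf{mcoh}$, and is the identity on variables. The reduced suspension functor $\Sigma_r:\mathrm{Syn}(\mathsf{MCaTT})\to\mathrm{Syn}(\mathsf{CaTT})$ adds a fresh variable $\bullet:\star$, sends $\mathbb{1}$ to $\star$, $()$ to $\bullet$, $\star=\mathrm{Hom}_{\mathbb{1}}()()$ to $\mathrm{Hom}_\star\bullet\bullet$, drops context variables of type $\mathbb{1}$, keeps other variables, and sends $\mathsf{mop}_{\Theta,A}[\gamma]$ to $\mathsf{op}_{\Theta,A}[\bullet_\Theta\circ\Sigma_r\gamma]$ (similarly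 for $\mathsf{mcoh}$). For a $\mathsf{CaTT}$ context $\Gamma$, $\bullet_\Gamma$ is defined by $\bullet_\emptyset=\langle\rangle$ and $\bullet_{(\Gamma,x:A)}=\langle\bullet_\Gamma,x\mapsto\Sigma_r(\mathrm{D}x)\rangle$ (so $x\mapsto\bullet$ if $A=\star$ and $x\mapsto x$ otherwise). -}

module Defs where

open import Data.Nat using (ℕ; zero; suc; _⊔_; _≟_; _≤?_; _<?_)
open import Data.Bool using (Bool; true; false; if_then_else_)
open import Data.List using (List; []; _∷_; _++_)
open import Data.List.Membership.Propositional using (_∈_)
open import Data.Maybe using (Maybe; just; nothing)
open import Data.Product using (_×_; _,_)
open import Relation.Nullary using (¬_; yes; no)
open import Relation.Binary.PropositionalEquality using (_≡_)

Name : Set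
Name = ℕ

infixl 5 _▸_∶_ _▸_↦_ _▸ᵐ_∶_ _▸ᵐ_↦_

mutual
  data Ty : Set where
    ⋆   : Ty
    Hom : Ty → Tm → Tm → Ty

  data Tm : Set where
    var : Name → Tm
    op  : Ctx → Ty → Sub → Tm
    coh : Ctx → Ty → Sub → Tm

  -- a substitution Δ → Γ assigns to each variable of Γ a term over Δ
  data Sub : Set where
    ⟨⟩    : Sub
    _▸_↦_ : Sub → Name → Tm → Sub

  data Ctx : Set where
    ∅     : Ctx
    _▸_∶_ : Ctx → Name → Ty → Ctx

lookupS : Sub → Name → Maybe Tm
lookupS ⟨⟩ x = nothing
lookupS (γ ▸ y ↦ t) x with x ≟ y
... | yes _ = just t
... | no  _ = lookupS γ x

substVar : Maybe Tm → Name → Tm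
substVar (just t) x = t
substVar nothing  x = var x

mutual
  _[_]ty : Ty → Sub → Ty
  ⋆ [ δ ]ty = ⋆
  Hom A t u [ δ ]ty = Hom (A [ δ ]ty) (t [ δ ]tm) (u [ δ ]tm)

  _[_]tm : Tm → Sub → Tm
  var x [ δ ]tm = substVar (lookupS δ x) x
  op Θ A γ [ δ ]tm = op Θ A (γ ∘ₛ δ)
  coh Θ A γ [ δ ]tm = coh Θ A (γ ∘ₛ δ)

  -- if γ : Δ → Γ and δ : Δ' → Δ then γ ∘ₛ δ : Δ' → Γ
  _∘ₛ_ : Sub → Sub → Sub
  ⟨⟩ ∘ₛ δ = ⟨⟩
  (γ ▸ x ↦ t) ∘ₛ δ = (γ ∘ₛ δ) ▸ x ↦ (t [ δ ]tm)

mutual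
  varsTy : Ty → List Name
  varsTy ⋆ = []
  varsTy (Hom A t u) = varsTy A ++ (varsTm t ++ varsTm u)

  varsTm : Tm → List Name
  varsTm (var x) = x ∷ []
  varsTm (op _ _ γ) = varsSub γ
  varsTm (coh _ _ γ) = varsSub γ

  varsSub : Sub → List Name
  varsSub ⟨⟩ = []
  varsSub (γ ▸ _ ↦ t) = varsSub γ ++ varsTm t

names : Ctx → List Name
names ∅ = []
names (Γ ▸ x ∶ _) = names Γ ++ (x ∷ [])

_≈ₗ_ : List Name → List Name → Set
L₁ ≈ₗ L₂ = ∀ x → ((x ∈ L₁ → x ∈ L₂) × (x ∈ L₂ → x ∈ L₁))

dimTy : Ty → ℕ
dimTy ⋆ = 0
dimTy (Hom A _ _) = suc (dimTy A)

dimCtx : Ctx → ℕ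
dimCtx ∅ = 0
dimCtx (Γ ▸ _ ∶ A) = dimCtx Γ ⊔ dimTy A

dropLast : Ctx → Ctx
dropLast ∅ = ∅
dropLast (Γ ▸ _ ∶ _) = Γ

-- i-source and i-target of a ps-context (Finster–Mimram)
∂⁻ : ℕ → Ctx → Ctx
∂⁻ i ∅ = ∅
∂⁻ i (∅ ▸ x ∶ A) = ∅ ▸ x ∶ A
∂⁻ i ((Γ ▸ y ∶ A) ▸ f ∶ B) with i ≤? dimTy A
... | yes _ = ∂⁻ i Γ
... | no  _ = (∂⁻ i Γ ▸ y ∶ A) ▸ f ∶ B

∂⁺ : ℕ → Ctx → Ctx
∂⁺ i ∅ = ∅
∂⁺ i (∅ ▸ x ∶ A) = ∅ ▸ x ∶ A
∂⁺ i ((Γ ▸ y ∶ A) ▸ f ∶ B) with i <? dimTy A | i ≟ dimTy A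
... | yes _ | _     = ∂⁺ i Γ
... | no  _ | yes _ = dropLast (∂⁺ i Γ) ▸ y ∶ A
... | no  _ | no  _ = (∂⁺ i Γ ▸ y ∶ A) ▸ f ∶ B

data _⊢ps_∶_ : Ctx → Name → Ty → Set where
  pss : ∀ {x} → (∅ ▸ x ∶ ⋆) ⊢ps x ∶ ⋆
  pse : ∀ {Γ x A y f} → Γ ⊢ps x ∶ A →
        ¬ (y ∈ names Γ) → ¬ (f ∈ names Γ) → ¬ (y ≡ f) →
        ((Γ ▸ y ∶ A) ▸ f ∶ Hom A (var x) (var y)) ⊢ps f ∶ Hom A (var x) (var y)
  psd : ∀ {Γ f A x y} → Γ ⊢ps f ∶ Hom A (var x) (var y) → Γ ⊢ps y ∶ A

data PS (Γ : Ctx) : Set where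
  ps : ∀ {x} → Γ ⊢ps x ∶ ⋆ → PS Γ

data _∈ᶜ_ : Name × Ty → Ctx → Set where
  here  : ∀ {Γ x A} → (x , A) ∈ᶜ (Γ ▸ x ∶ A)
  there : ∀ {Γ x A y B} → (x , A) ∈ᶜ Γ → (x , A) ∈ᶜ (Γ ▸ y ∶ B)

mutual
  data ⊢ᶜ_ : Ctx → Set where
    ⊢∅ : ⊢ᶜ ∅
    ⊢▸ : ∀ {Γ x A} → Γ ⊢ty A → ¬ (x ∈ names Γ) → ⊢ᶜ (Γ ▸ x ∶ A)

  data _⊢ty_ : Ctx → Ty → Set where
    ⊢⋆   : ∀ {Γ} → ⊢ᶜ Γ → Γ ⊢ty ⋆
    ⊢Hom : ∀ {Γ A t u} → Γ ⊢ t ∶ A → Γ ⊢ u ∶ A → Γ ⊢ty Hom A t u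

  data _⊢_∶_ : Ctx → Tm → Ty → Set where
    ⊢var : ∀ {Γ x A} → ⊢ᶜ Γ → (x , A) ∈ᶜ Γ → Γ ⊢ var x ∶ A
    ⊢op  : ∀ {Θ Δ A t u k γ} → PS Θ → dimCtx Θ ≡ suc k →
           ∂⁻ k Θ ⊢ t ∶ A → ∂⁺ k Θ ⊢ u ∶ A →
           (varsTm t ++ varsTy A) ≈ₗ names (∂⁻ k Θ) →
           (varsTm u ++ varsTy A) ≈ₗ names (∂⁺ k Θ) →
           Δ ⊢ₛ γ ∶ Θ →
           Δ ⊢ op Θ (Hom A t u) γ ∶ (Hom A t u [ γ ]ty)
    ⊢coh : ∀ {Θ Δ A t u γ} → PS Θ →
           Θ ⊢ t ∶ A → Θ ⊢ u ∶ A →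
           (varsTm t ++ varsTy A) ≈ₗ names Θ →
           (varsTm u ++ varsTy A) ≈ₗ names Θ →
           Δ ⊢ₛ γ ∶ Θ →
           Δ ⊢ coh Θ (Hom A t u) γ ∶ (Hom A t u [ γ ]ty)

  data _⊢ₛ_∶_ : Ctx → Sub → Ctx → Set where
    ⊢⟨⟩ : ∀ {Δ} → ⊢ᶜ Δ → Δ ⊢ₛ ⟨⟩ ∶ ∅
    ⊢▸ₛ : ∀ {Δ γ Γ x A t} → Δ ⊢ₛ γ ∶ Γ → ⊢ᶜ (Γ ▸ x ∶ A) →
          Δ ⊢ t ∶ (A [ γ ]ty) → Δ ⊢ₛ (γ ▸ x ↦ t) ∶ (Γ ▸ x ∶ A)

mutual
  data MTy : Set where
    𝟙    : MTy
    MHom : MTy → MTm → MTm → MTy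

  data MTm : Set where
    mvar : Name → MTm
    unit : MTm
    mop  : Ctx → Ty → MSub → MTm
    mcoh : Ctx → Ty → MSub → MTm

  data MSub : Set where
    ⟨⟩ᵐ    : MSub
    _▸ᵐ_↦_ : MSub → Name → MTm → MSub

data MCtx : Set where
  ∅ᵐ     : MCtx
  _▸ᵐ_∶_ : MCtx → Name → MTy → MCtx

mutual
  D-ty : Ty → MTy
  D-ty ⋆ = 𝟙
  D-ty (Hom A t u) = MHom (D-ty A) (D-tm t) (D-tm u)

  D-tm : Tm → MTm
  D-tm (var x) = mvar x
  D-tm (op Θ A γ) = mop Θ A (D-sub γ)
  D-tm (coh Θ A γ) = mcoh Θ A (D-sub γ)

  D-sub : Sub → MSub
  D-sub ⟨⟩ = ⟨⟩ᵐ
  D-sub (γ ▸ x ↦ t) = D-sub γ ▸ᵐ x ↦ D-tm t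

D-ctx : Ctx → MCtx
D-ctx ∅ = ∅ᵐ
D-ctx (Γ ▸ x ∶ A) = D-ctx Γ ▸ᵐ x ∶ D-ty A

-- the fresh variable • added by Σr to an MCaTT context
maxName : MCtx → Name
maxName ∅ᵐ = 0
maxName (Γ ▸ᵐ x ∶ _) = maxName Γ ⊔ x

fresh : MCtx → Name
fresh Γ = suc (maxName Γ)

lookupM : MCtx → Name → Maybe MTy
lookupM ∅ᵐ x = nothing
lookupM (Γ ▸ᵐ y ∶ A) x with x ≟ y
... | yes _ = just A
... | no  _ = lookupM Γ x

isUnitTy : Maybe MTy → Bool
isUnitTy (just 𝟙) = true
isUnitTy _ = false

-- Σr on a variable x of the MCaTT context Δ, with b the name of •:
-- variables of type 𝟙 are (by η) equal to () and go to •
Σr-var : Name → MCtx → Name → Tm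
Σr-var b Δ x = if isUnitTy (lookupM Δ x) then var b else var x

bulletAux : Name → MCtx → Ctx → Sub
bulletAux b Δ ∅ = ⟨⟩
bulletAux b Δ (Γ ▸ x ∶ _) = bulletAux b Δ Γ ▸ x ↦ Σr-var b Δ x

bullet : Ctx → Sub
bullet Γ = bulletAux (fresh (D-ctx Γ)) (D-ctx Γ) Γ

mutual
  Σr-ty : Name → MCtx → MTy → Ty
  Σr-ty b Δ 𝟙 = ⋆
  Σr-ty b Δ (MHom A t u) = Hom (Σr-ty b Δ A) (Σr-tm b Δ t) (Σr-tm b Δ u)

  Σr-tm : Name → MCtx → MTm → Tm
  Σr-tm b Δ (mvar x) = Σr-var b Δ x
  Σr-tm b Δ unit = var b
  Σr-tm b Δ (mop Θ A γ) = op Θ A (bullet Θ ∘ₛ Σr-sub b Δ (D-ctx Θ) γ)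
  Σr-tm b Δ (mcoh Θ A γ) = coh Θ A (bullet Θ ∘ₛ Σr-sub b Δ (D-ctx Θ) γ)

  Σr-sub : Name → MCtx → MCtx → MSub → Sub
  Σr-sub b Δ Γ ⟨⟩ᵐ = ⟨⟩ ▸ fresh Γ ↦ var b
  Σr-sub b Δ Γ (γ ▸ᵐ x ↦ t) =
    if isUnitTy (lookupM Γ x) then Σr-sub b Δ Γ γ
    else (Σr-sub b Δ Γ γ ▸ x ↦ Σr-tm b Δ t)

Σr-subst : MCtx → MCtx → MSub → Sub
Σr-subst Δ Γ γ = Σr-sub (fresh Δ) Δ Γ γ

Σr-ctxAux : Name → MCtx → MCtx → Ctx
Σr-ctxAux b Δ ∅ᵐ = ∅ ▸ b ∶ ⋆
Σr-ctxAux b Δ (Γ ▸ᵐ x ∶ 𝟙) = Σr-ctxAux b Δ Γ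
Σr-ctxAux b Δ (Γ ▸ᵐ x ∶ MHom A t u) = Σr-ctxAux b Δ Γ ▸ x ∶ Σr-ty b Δ (MHom A t u)

Σr-ctx : MCtx → Ctx
Σr-ctx Δ = Σr-ctxAux (fresh Δ) Δ Δ

-- Substituting along •_Γ, which sends the variables of type ⋆ to • and fixes the
-- others, computes Σr ∘ D: t [ •_Γ ] = Σr (D t) for every well-typed t. This is
-- proved by a mutual induction whose op/coh case is naturality at a ps-context.
-- Typing of •_Γ follows, since the variables of Σr (D Γ) have types
-- Σr (D A) = A [ •_Γ ]. Naturality is checked variable by variable: a variable of
-- type ⋆ is sent by γ to a variable of type ⋆, which both sides send to •, and a
-- variable x of Hom-type is sent to Σr (D (γ x)) by both sides.
module Submission where

open import Defs
open import Data.Bool using (true; false)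
open import Data.Empty using (⊥-elim)
open import Data.List using (List; []; _∷_; _++_)
open import Data.List.Membership.Propositional using (_∈_; _∉_)
open import Data.List.Membership.Propositional.Properties using (∈-++⁻; ∈-++⁺ʳ)
open import Data.List.Relation.Binary.Subset.Propositional using (_⊆_)
open import Data.List.Relation.Binary.Subset.Propositional.Properties
  using (⊆-trans; ⊆-reflexive; xs⊆xs++ys; xs⊆ys++xs; ∷⁺ʳ)
open import Data.List.Relation.Unary.Any using () renaming (here to ∈-here; there to ∈-there)
open import Data.Maybe using (just)
import Data.Maybe as Maybe
open import Data.Nat using (_≤_; _≟_; _≤?_; _<?_)
open import Data.Nat.Properties using (m≤m⊔n; m≤n⊔m; ≤-trans; 1+n≰n)
open import Data.Product using (_×_; _,_; ∃; proj₁)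
open import Data.Sum using (_⊎_; inj₁; inj₂; [_,_]′)
open import Function using (_∘_)
open import Relation.Binary.PropositionalEquality
  using (_≡_; _≢_; refl; sym; trans; cong; cong₂; subst; subst₂)
open import Relation.Nullary using (yes; no)

cong₃ : ∀ {A B C D : Set} (f : A → B → C → D) {a a′ b b′ c c′} →
        a ≡ a′ → b ≡ b′ → c ≡ c′ → f a b c ≡ f a′ b′ c′
cong₃ f refl refl refl = refl

++-⊆ : ∀ {xs ys zs : List Name} → xs ⊆ zs → ys ⊆ zs → xs ++ ys ⊆ zs
++-⊆ {xs} p q m = [ p , q ]′ (∈-++⁻ xs m)

x∈xs++[x] : ∀ (xs : List Name) {x} → x ∈ xs ++ x ∷ []
x∈xs++[x] xs = ∈-++⁺ʳ xs (∈-here refl)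

∈-++[x]⁻ : ∀ (xs : List Name) {x y} → y ∈ xs ++ x ∷ [] → y ∈ xs ⊎ y ≡ x
∈-++[x]⁻ xs m with ∈-++⁻ xs m
... | inj₁ q = inj₁ q
... | inj₂ (∈-here e) = inj₂ e

module _ (A : Ty) (t u : Tm) where

  varsTy⊆Hom : varsTy A ⊆ varsTy (Hom A t u)
  varsTy⊆Hom = xs⊆xs++ys _ _

  varsTm-src⊆Hom : varsTm t ⊆ varsTy (Hom A t u)
  varsTm-src⊆Hom = ⊆-trans (xs⊆xs++ys _ _) (xs⊆ys++xs _ (varsTy A))

  varsTm-tgt⊆Hom : varsTm u ⊆ varsTy (Hom A t u)
  varsTm-tgt⊆Hom = ⊆-trans (xs⊆ys++xs _ (varsTm t)) (xs⊆ys++xs _ (varsTy A))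

  varsTy-Hom⊆ : ∀ {xs} → varsTm t ++ varsTy A ⊆ xs → varsTm u ++ varsTy A ⊆ xs →
                varsTy (Hom A t u) ⊆ xs
  varsTy-Hom⊆ src tgt =
    ++-⊆ (src ∘ xs⊆ys++xs _ (varsTm t))
         (++-⊆ (src ∘ xs⊆xs++ys _ (varsTy A)) (tgt ∘ xs⊆xs++ys _ (varsTy A)))

module _ (γ : Sub) (x : Name) (t : Tm) where

  varsSub⊆▸ : varsSub γ ⊆ varsSub (γ ▸ x ↦ t)
  varsSub⊆▸ = xs⊆xs++ys _ _

  varsTm⊆▸ : varsTm t ⊆ varsSub (γ ▸ x ↦ t)
  varsTm⊆▸ = xs⊆ys++xs _ (varsSub γ)

dom : Sub → List Name
dom ⟨⟩ = []
dom (γ ▸ x ↦ _) = dom γ ++ x ∷ []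

lookupS-here : ∀ γ x t → lookupS (γ ▸ x ↦ t) x ≡ just t
lookupS-here γ x t with x ≟ x
... | yes _ = refl
... | no x≢x = ⊥-elim (x≢x refl)

lookupS-there : ∀ γ {x y} t → x ≢ y → lookupS (γ ▸ y ↦ t) x ≡ lookupS γ x
lookupS-there γ {x} {y} t x≢y with x ≟ y
... | yes x≡y = ⊥-elim (x≢y x≡y)
... | no _ = refl

lookupS-∘ₛ : ∀ γ δ x → lookupS (γ ∘ₛ δ) x ≡ Maybe.map (_[ δ ]tm) (lookupS γ x)
lookupS-∘ₛ ⟨⟩ δ x = refl
lookupS-∘ₛ (γ ▸ y ↦ t) δ x with x ≟ y
... | yes _ = refl
... | no _ = lookupS-∘ₛ γ δ x

∈dom⇒lookupS : ∀ γ {x} → x ∈ dom γ → ∃ λ s → lookupS γ x ≡ just s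
∈dom⇒lookupS (γ ▸ y ↦ t) {x} m with x ≟ y
... | yes _ = t , refl
... | no x≢y with ∈-++⁻ (dom γ) m
...   | inj₁ q = ∈dom⇒lookupS γ q
...   | inj₂ (∈-here x≡y) = ⊥-elim (x≢y x≡y)

lookupS⇒varsTm⊆ : ∀ γ {x s} → lookupS γ x ≡ just s → varsTm s ⊆ varsSub γ
lookupS⇒varsTm⊆ (γ ▸ y ↦ t) {x} eq with x ≟ y
lookupS⇒varsTm⊆ (γ ▸ y ↦ t) refl | yes _ = varsTm⊆▸ γ y t
... | no _ = varsSub⊆▸ γ y t ∘ lookupS⇒varsTm⊆ γ eq

var-[]-here : ∀ γ x t → var x [ γ ▸ x ↦ t ]tm ≡ t
var-[]-here γ x t = cong (λ m → substVar m x) (lookupS-here γ x t)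

var-[]-there : ∀ γ {x y} t → x ≢ y → var x [ γ ▸ y ↦ t ]tm ≡ var x [ γ ]tm
var-[]-there γ {x} t x≢y = cong (λ m → substVar m x) (lookupS-there γ t x≢y)

_≗_on_ : Sub → Sub → List Name → Set
γ ≗ δ on xs = ∀ {x} → x ∈ xs → lookupS γ x ≡ lookupS δ x

▸-≗-on : ∀ {γ y s xs} → y ∉ xs → (γ ▸ y ↦ s) ≗ γ on xs
▸-≗-on {γ} {s = s} {xs} y∉xs x∈xs = lookupS-there γ s (λ { refl → y∉xs x∈xs })

mutual
  []ty-≗ : ∀ A {γ δ} → γ ≗ δ on varsTy A → A [ γ ]ty ≡ A [ δ ]ty
  []ty-≗ ⋆ _ = refl
  []ty-≗ (Hom A t u) eq =
    cong₃ Hom ([]ty-≗ A (eq ∘ varsTy⊆Hom A t u))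
              ([]tm-≗ t (eq ∘ varsTm-src⊆Hom A t u))
              ([]tm-≗ u (eq ∘ varsTm-tgt⊆Hom A t u))

  []tm-≗ : ∀ t {γ δ} → γ ≗ δ on varsTm t → t [ γ ]tm ≡ t [ δ ]tm
  []tm-≗ (var x) eq = cong (λ m → substVar m x) (eq (∈-here refl))
  []tm-≗ (op Θ A σ) eq = cong (op Θ A) (∘ₛ-≗ σ eq)
  []tm-≗ (coh Θ A σ) eq = cong (coh Θ A) (∘ₛ-≗ σ eq)

  ∘ₛ-≗ : ∀ σ {γ δ} → γ ≗ δ on varsSub σ → σ ∘ₛ γ ≡ σ ∘ₛ δ
  ∘ₛ-≗ ⟨⟩ _ = refl
  ∘ₛ-≗ (σ ▸ x ↦ t) eq =
    cong₂ (_▸ x ↦_) (∘ₛ-≗ σ (eq ∘ varsSub⊆▸ σ x t)) ([]tm-≗ t (eq ∘ varsTm⊆▸ σ x t))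

var-[]-∘ₛ : ∀ γ δ {x} → x ∈ dom γ → (var x [ γ ]tm) [ δ ]tm ≡ var x [ γ ∘ₛ δ ]tm
var-[]-∘ₛ γ δ {x} x∈γ with ∈dom⇒lookupS γ x∈γ
... | s , eq rewrite lookupS-∘ₛ γ δ x | eq = refl

mutual
  []ty-∘ₛ : ∀ A γ δ → varsTy A ⊆ dom γ → (A [ γ ]ty) [ δ ]ty ≡ A [ γ ∘ₛ δ ]ty
  []ty-∘ₛ ⋆ γ δ _ = refl
  []ty-∘ₛ (Hom A t u) γ δ ⊆γ =
    cong₃ Hom ([]ty-∘ₛ A γ δ (⊆γ ∘ varsTy⊆Hom A t u))
              ([]tm-∘ₛ t γ δ (⊆γ ∘ varsTm-src⊆Hom A t u))
              ([]tm-∘ₛ u γ δ (⊆γ ∘ varsTm-tgt⊆Hom A t u))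

  []tm-∘ₛ : ∀ t γ δ → varsTm t ⊆ dom γ → (t [ γ ]tm) [ δ ]tm ≡ t [ γ ∘ₛ δ ]tm
  []tm-∘ₛ (var x) γ δ ⊆γ = var-[]-∘ₛ γ δ (⊆γ (∈-here refl))
  []tm-∘ₛ (op Θ A σ) γ δ ⊆γ = cong (op Θ A) (∘ₛ-assoc σ γ δ ⊆γ)
  []tm-∘ₛ (coh Θ A σ) γ δ ⊆γ = cong (coh Θ A) (∘ₛ-assoc σ γ δ ⊆γ)

  ∘ₛ-assoc : ∀ σ γ δ → varsSub σ ⊆ dom γ → (σ ∘ₛ γ) ∘ₛ δ ≡ σ ∘ₛ (γ ∘ₛ δ)
  ∘ₛ-assoc ⟨⟩ γ δ _ = refl
  ∘ₛ-assoc (σ ▸ x ↦ t) γ δ ⊆γ =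
    cong₂ (_▸ x ↦_) (∘ₛ-assoc σ γ δ (⊆γ ∘ varsSub⊆▸ σ x t))
                    ([]tm-∘ₛ t γ δ (⊆γ ∘ varsTm⊆▸ σ x t))

mutual
  varsTy-[] : ∀ A γ → varsTy A ⊆ dom γ → varsTy (A [ γ ]ty) ⊆ varsSub γ
  varsTy-[] ⋆ γ _ ()
  varsTy-[] (Hom A t u) γ ⊆γ =
    ++-⊆ (varsTy-[] A γ (⊆γ ∘ varsTy⊆Hom A t u))
         (++-⊆ (varsTm-[] t γ (⊆γ ∘ varsTm-src⊆Hom A t u))
               (varsTm-[] u γ (⊆γ ∘ varsTm-tgt⊆Hom A t u)))

  varsTm-[] : ∀ t γ → varsTm t ⊆ dom γ → varsTm (t [ γ ]tm) ⊆ varsSub γ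
  varsTm-[] (var x) γ ⊆γ with ∈dom⇒lookupS γ (⊆γ (∈-here refl))
  ... | s , eq rewrite eq = lookupS⇒varsTm⊆ γ eq
  varsTm-[] (op Θ A σ) γ ⊆γ = varsSub-∘ₛ σ γ ⊆γ
  varsTm-[] (coh Θ A σ) γ ⊆γ = varsSub-∘ₛ σ γ ⊆γ

  varsSub-∘ₛ : ∀ σ γ → varsSub σ ⊆ dom γ → varsSub (σ ∘ₛ γ) ⊆ varsSub γ
  varsSub-∘ₛ ⟨⟩ γ _ ()
  varsSub-∘ₛ (σ ▸ x ↦ t) γ ⊆γ =
    ++-⊆ (varsSub-∘ₛ σ γ (⊆γ ∘ varsSub⊆▸ σ x t)) (varsTm-[] t γ (⊆γ ∘ varsTm⊆▸ σ x t))

_⊆ᶜ_ : Ctx → Ctx → Set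
Γ ⊆ᶜ Γ′ = ∀ {x A} → (x , A) ∈ᶜ Γ → (x , A) ∈ᶜ Γ′

∈ᶜ⇒∈names : ∀ {Γ x A} → (x , A) ∈ᶜ Γ → x ∈ names Γ
∈ᶜ⇒∈names {Γ ▸ _ ∶ _} here = x∈xs++[x] (names Γ)
∈ᶜ⇒∈names {Γ ▸ _ ∶ _} (there p) = xs⊆xs++ys (names Γ) _ (∈ᶜ⇒∈names p)

∈names⇒∈ᶜ : ∀ Γ {x} → x ∈ names Γ → ∃ λ A → (x , A) ∈ᶜ Γ
∈names⇒∈ᶜ (Γ ▸ y ∶ B) m with ∈-++[x]⁻ (names Γ) m
... | inj₁ q = let A , p = ∈names⇒∈ᶜ Γ q in A , there p
... | inj₂ refl = B , here

⊆ᶜ⇒names⊆ : ∀ Γ {Γ′} → Γ ⊆ᶜ Γ′ → names Γ ⊆ names Γ′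
⊆ᶜ⇒names⊆ Γ Γ⊆Γ′ m = let _ , p = ∈names⇒∈ᶜ Γ m in ∈ᶜ⇒∈names (Γ⊆Γ′ p)

dropLast-⊆ᶜ : ∀ Γ → dropLast Γ ⊆ᶜ Γ
dropLast-⊆ᶜ (Γ ▸ _ ∶ _) = there

∂⁻-⊆ᶜ : ∀ i Θ → ∂⁻ i Θ ⊆ᶜ Θ
∂⁻-⊆ᶜ i (∅ ▸ _ ∶ _) p = p
∂⁻-⊆ᶜ i ((Γ ▸ y ∶ A) ▸ f ∶ B) p with i ≤? dimTy A
... | yes _ = there (there (∂⁻-⊆ᶜ i Γ p))
... | no _ with p
...   | here = here
...   | there here = there here
...   | there (there q) = there (there (∂⁻-⊆ᶜ i Γ q))

∂⁺-⊆ᶜ : ∀ i Θ → ∂⁺ i Θ ⊆ᶜ Θ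
∂⁺-⊆ᶜ i (∅ ▸ _ ∶ _) p = p
∂⁺-⊆ᶜ i ((Γ ▸ y ∶ A) ▸ f ∶ B) p with i <? dimTy A | i ≟ dimTy A
... | yes _ | _ = there (there (∂⁺-⊆ᶜ i Γ p))
... | no _ | yes _ with p
...   | here = there here
...   | there q = there (there (∂⁺-⊆ᶜ i Γ (dropLast-⊆ᶜ (∂⁺ i Γ) q)))
∂⁺-⊆ᶜ i ((Γ ▸ y ∶ A) ▸ f ∶ B) p | no _ | no _ with p
...   | here = here
...   | there here = there here
...   | there (there q) = there (there (∂⁺-⊆ᶜ i Γ q))

≈ₗ⇒⊆ : ∀ {xs ys} → xs ≈ₗ ys → xs ⊆ ys
≈ₗ⇒⊆ xs≈ys {x} = proj₁ (xs≈ys x)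

op-varsTy⊆ : ∀ Θ k A t u →
  (varsTm t ++ varsTy A) ≈ₗ names (∂⁻ k Θ) → (varsTm u ++ varsTy A) ≈ₗ names (∂⁺ k Θ) →
  varsTy (Hom A t u) ⊆ names Θ
op-varsTy⊆ Θ k A t u src tgt =
  varsTy-Hom⊆ A t u (⊆ᶜ⇒names⊆ (∂⁻ k Θ) (∂⁻-⊆ᶜ k Θ) ∘ ≈ₗ⇒⊆ src)
              (⊆ᶜ⇒names⊆ (∂⁺ k Θ) (∂⁺-⊆ᶜ k Θ) ∘ ≈ₗ⇒⊆ tgt)

coh-varsTy⊆ : ∀ Θ A t u →
  (varsTm t ++ varsTy A) ≈ₗ names Θ → (varsTm u ++ varsTy A) ≈ₗ names Θ →
  varsTy (Hom A t u) ⊆ names Θ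
coh-varsTy⊆ Θ A t u src tgt = varsTy-Hom⊆ A t u (≈ₗ⇒⊆ src) (≈ₗ⇒⊆ tgt)

mutual
  ⊢ty⇒⊢ᶜ : ∀ {Γ A} → Γ ⊢ty A → ⊢ᶜ Γ
  ⊢ty⇒⊢ᶜ (⊢⋆ ⊢Γ) = ⊢Γ
  ⊢ty⇒⊢ᶜ (⊢Hom ⊢t _) = ⊢tm⇒⊢ᶜ ⊢t

  ⊢tm⇒⊢ᶜ : ∀ {Γ t A} → Γ ⊢ t ∶ A → ⊢ᶜ Γ
  ⊢tm⇒⊢ᶜ (⊢var ⊢Γ _) = ⊢Γ
  ⊢tm⇒⊢ᶜ (⊢op _ _ _ _ _ _ ⊢γ) = ⊢ₛ⇒⊢ᶜ ⊢γ
  ⊢tm⇒⊢ᶜ (⊢coh _ _ _ _ _ ⊢γ) = ⊢ₛ⇒⊢ᶜ ⊢γ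

  ⊢ₛ⇒⊢ᶜ : ∀ {Δ γ Θ} → Δ ⊢ₛ γ ∶ Θ → ⊢ᶜ Δ
  ⊢ₛ⇒⊢ᶜ (⊢⟨⟩ ⊢Δ) = ⊢Δ
  ⊢ₛ⇒⊢ᶜ (⊢▸ₛ ⊢γ _ _) = ⊢ₛ⇒⊢ᶜ ⊢γ

⊢ₛ⇒⊢ᶜ-cod : ∀ {Δ γ Θ} → Δ ⊢ₛ γ ∶ Θ → ⊢ᶜ Θ
⊢ₛ⇒⊢ᶜ-cod (⊢⟨⟩ _) = ⊢∅
⊢ₛ⇒⊢ᶜ-cod (⊢▸ₛ _ ⊢Θ _) = ⊢Θ

⊢ᶜ▸⇒≢ : ∀ {Γ x A y} → ⊢ᶜ (Γ ▸ x ∶ A) → y ∈ names Γ → y ≢ x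
⊢ᶜ▸⇒≢ (⊢▸ _ x∉Γ) y∈Γ refl = x∉Γ y∈Γ

dom-⊢ₛ : ∀ {Δ γ Θ} → Δ ⊢ₛ γ ∶ Θ → dom γ ≡ names Θ
dom-⊢ₛ (⊢⟨⟩ _) = refl
dom-⊢ₛ (⊢▸ₛ {x = x} ⊢γ _ _) = cong (_++ x ∷ []) (dom-⊢ₛ ⊢γ)

names⊆dom : ∀ {Δ γ Θ} → Δ ⊢ₛ γ ∶ Θ → names Θ ⊆ dom γ
names⊆dom ⊢γ = ⊆-reflexive (sym (dom-⊢ₛ ⊢γ))

mutual
  ⊢tm⇒varsTm⊆ : ∀ {Γ t A} → Γ ⊢ t ∶ A → varsTm t ⊆ names Γ
  ⊢tm⇒varsTm⊆ (⊢var _ p) (∈-here refl) = ∈ᶜ⇒∈names p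
  ⊢tm⇒varsTm⊆ (⊢op _ _ _ _ _ _ ⊢γ) = ⊢ₛ⇒varsSub⊆ ⊢γ
  ⊢tm⇒varsTm⊆ (⊢coh _ _ _ _ _ ⊢γ) = ⊢ₛ⇒varsSub⊆ ⊢γ

  ⊢ₛ⇒varsSub⊆ : ∀ {Δ γ Θ} → Δ ⊢ₛ γ ∶ Θ → varsSub γ ⊆ names Δ
  ⊢ₛ⇒varsSub⊆ (⊢⟨⟩ _) ()
  ⊢ₛ⇒varsSub⊆ (⊢▸ₛ ⊢γ _ ⊢t) = ++-⊆ (⊢ₛ⇒varsSub⊆ ⊢γ) (⊢tm⇒varsTm⊆ ⊢t)

  ⊢tm⇒varsTy⊆ : ∀ {Γ t A} → Γ ⊢ t ∶ A → varsTy A ⊆ names Γ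
  ⊢tm⇒varsTy⊆ (⊢var ⊢Γ p) = ∈ᶜ⇒varsTy⊆ ⊢Γ p
  ⊢tm⇒varsTy⊆ (⊢op {Θ} {A = A} {t} {u} {k} {γ} _ _ _ _ src tgt ⊢γ) =
    ⊢ₛ⇒varsSub⊆ ⊢γ ∘ varsTy-[] (Hom A t u) γ (names⊆dom ⊢γ ∘ op-varsTy⊆ Θ k A t u src tgt)
  ⊢tm⇒varsTy⊆ (⊢coh {Θ} {A = A} {t} {u} {γ} _ _ _ src tgt ⊢γ) =
    ⊢ₛ⇒varsSub⊆ ⊢γ ∘ varsTy-[] (Hom A t u) γ (names⊆dom ⊢γ ∘ coh-varsTy⊆ Θ A t u src tgt)

  ⊢ty⇒varsTy⊆ : ∀ {Γ A} → Γ ⊢ty A → varsTy A ⊆ names Γ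
  ⊢ty⇒varsTy⊆ (⊢⋆ _) ()
  ⊢ty⇒varsTy⊆ (⊢Hom ⊢t ⊢u) =
    ++-⊆ (⊢tm⇒varsTy⊆ ⊢t) (++-⊆ (⊢tm⇒varsTm⊆ ⊢t) (⊢tm⇒varsTm⊆ ⊢u))

  ∈ᶜ⇒varsTy⊆ : ∀ {Γ x A} → ⊢ᶜ Γ → (x , A) ∈ᶜ Γ → varsTy A ⊆ names Γ
  ∈ᶜ⇒varsTy⊆ {Γ ▸ _ ∶ _} (⊢▸ ⊢A _) here = xs⊆xs++ys (names Γ) _ ∘ ⊢ty⇒varsTy⊆ ⊢A
  ∈ᶜ⇒varsTy⊆ {Γ ▸ _ ∶ _} (⊢▸ ⊢B _) (there p) =
    xs⊆xs++ys (names Γ) _ ∘ ∈ᶜ⇒varsTy⊆ (⊢ty⇒⊢ᶜ ⊢B) p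

_⊢ᵛ_∶_ : Ctx → Sub → Ctx → Set
Δ ⊢ᵛ δ ∶ Γ = ∀ {x A} → (x , A) ∈ᶜ Γ → Δ ⊢ (var x [ δ ]tm) ∶ (A [ δ ]ty)

⊢ₛ⇒⊢ᵛ : ∀ {Δ γ Θ} → Δ ⊢ₛ γ ∶ Θ → Δ ⊢ᵛ γ ∶ Θ
⊢ₛ⇒⊢ᵛ {Δ} (⊢▸ₛ {γ = γ} {x = x} {A = A} {t = t} _ (⊢▸ ⊢A x∉Θ) ⊢t) here =
  subst₂ (Δ ⊢_∶_) (sym (var-[]-here γ x t))
    (sym ([]ty-≗ A (▸-≗-on (x∉Θ ∘ ⊢ty⇒varsTy⊆ ⊢A)))) ⊢t
⊢ₛ⇒⊢ᵛ {Δ} (⊢▸ₛ {γ = γ} {t = t} ⊢γ ⊢Θ▸@(⊢▸ ⊢B x∉Θ) _) {A = A} (there p) =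
  subst₂ (Δ ⊢_∶_) (sym (var-[]-there γ t (⊢ᶜ▸⇒≢ ⊢Θ▸ (∈ᶜ⇒∈names p))))
    (sym ([]ty-≗ A (▸-≗-on (x∉Θ ∘ ∈ᶜ⇒varsTy⊆ (⊢ty⇒⊢ᶜ ⊢B) p)))) (⊢ₛ⇒⊢ᵛ ⊢γ p)

mutual
  ⊢[]tm : ∀ {Γ t A Δ δ} → Γ ⊢ t ∶ A → ⊢ᶜ Δ → Δ ⊢ᵛ δ ∶ Γ → Δ ⊢ (t [ δ ]tm) ∶ (A [ δ ]ty)
  ⊢[]tm (⊢var _ p) _ ⊢δ = ⊢δ p
  ⊢[]tm {Δ = Δ} {δ} (⊢op {Θ} {A = A} {t} {u} {k} {γ} Θps dim ⊢t ⊢u src tgt ⊢γ) ⊢Δ ⊢δ =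
    subst (Δ ⊢ op Θ (Hom A t u) (γ ∘ₛ δ) ∶_)
      (sym ([]ty-∘ₛ (Hom A t u) γ δ (names⊆dom ⊢γ ∘ op-varsTy⊆ Θ k A t u src tgt)))
      (⊢op Θps dim ⊢t ⊢u src tgt (⊢∘ₛ ⊢γ ⊢Δ ⊢δ))
  ⊢[]tm {Δ = Δ} {δ} (⊢coh {Θ} {A = A} {t} {u} {γ} Θps ⊢t ⊢u src tgt ⊢γ) ⊢Δ ⊢δ =
    subst (Δ ⊢ coh Θ (Hom A t u) (γ ∘ₛ δ) ∶_)
      (sym ([]ty-∘ₛ (Hom A t u) γ δ (names⊆dom ⊢γ ∘ coh-varsTy⊆ Θ A t u src tgt)))
      (⊢coh Θps ⊢t ⊢u src tgt (⊢∘ₛ ⊢γ ⊢Δ ⊢δ))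

  ⊢∘ₛ : ∀ {Γ γ Θ Δ δ} → Γ ⊢ₛ γ ∶ Θ → ⊢ᶜ Δ → Δ ⊢ᵛ δ ∶ Γ → Δ ⊢ₛ γ ∘ₛ δ ∶ Θ
  ⊢∘ₛ (⊢⟨⟩ _) ⊢Δ _ = ⊢⟨⟩ ⊢Δ
  ⊢∘ₛ {Δ = Δ} {δ} (⊢▸ₛ {γ = γ} {A = A} {t = t} ⊢γ ⊢Θ▸@(⊢▸ ⊢A _) ⊢t) ⊢Δ ⊢δ =
    ⊢▸ₛ (⊢∘ₛ ⊢γ ⊢Δ ⊢δ) ⊢Θ▸
      (subst (Δ ⊢ (t [ δ ]tm) ∶_) ([]ty-∘ₛ A γ δ (names⊆dom ⊢γ ∘ ⊢ty⇒varsTy⊆ ⊢A))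
        (⊢[]tm ⊢t ⊢Δ ⊢δ))

⊢[]ty : ∀ {Γ A Δ δ} → Γ ⊢ty A → ⊢ᶜ Δ → Δ ⊢ᵛ δ ∶ Γ → Δ ⊢ty (A [ δ ]ty)
⊢[]ty (⊢⋆ _) ⊢Δ _ = ⊢⋆ ⊢Δ
⊢[]ty (⊢Hom ⊢t ⊢u) ⊢Δ ⊢δ = ⊢Hom (⊢[]tm ⊢t ⊢Δ ⊢δ) (⊢[]tm ⊢u ⊢Δ ⊢δ)

mutual
  ⊢tm-weaken : ∀ {Γ Γ′ t A} → Γ ⊢ t ∶ A → ⊢ᶜ Γ′ → Γ ⊆ᶜ Γ′ → Γ′ ⊢ t ∶ A
  ⊢tm-weaken (⊢var _ p) ⊢Γ′ Γ⊆Γ′ = ⊢var ⊢Γ′ (Γ⊆Γ′ p)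
  ⊢tm-weaken (⊢op Θps dim ⊢t ⊢u src tgt ⊢γ) ⊢Γ′ Γ⊆Γ′ =
    ⊢op Θps dim ⊢t ⊢u src tgt (⊢ₛ-weaken ⊢γ ⊢Γ′ Γ⊆Γ′)
  ⊢tm-weaken (⊢coh Θps ⊢t ⊢u src tgt ⊢γ) ⊢Γ′ Γ⊆Γ′ =
    ⊢coh Θps ⊢t ⊢u src tgt (⊢ₛ-weaken ⊢γ ⊢Γ′ Γ⊆Γ′)

  ⊢ₛ-weaken : ∀ {Γ Γ′ γ Θ} → Γ ⊢ₛ γ ∶ Θ → ⊢ᶜ Γ′ → Γ ⊆ᶜ Γ′ → Γ′ ⊢ₛ γ ∶ Θ
  ⊢ₛ-weaken (⊢⟨⟩ _) ⊢Γ′ _ = ⊢⟨⟩ ⊢Γ′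
  ⊢ₛ-weaken (⊢▸ₛ ⊢γ ⊢Θ ⊢t) ⊢Γ′ Γ⊆Γ′ =
    ⊢▸ₛ (⊢ₛ-weaken ⊢γ ⊢Γ′ Γ⊆Γ′) ⊢Θ (⊢tm-weaken ⊢t ⊢Γ′ Γ⊆Γ′)

⊢ty-weaken : ∀ {Γ Γ′ A} → Γ ⊢ty A → ⊢ᶜ Γ′ → Γ ⊆ᶜ Γ′ → Γ′ ⊢ty A
⊢ty-weaken (⊢⋆ _) ⊢Γ′ _ = ⊢⋆ ⊢Γ′
⊢ty-weaken (⊢Hom ⊢t ⊢u) ⊢Γ′ Γ⊆Γ′ =
  ⊢Hom (⊢tm-weaken ⊢t ⊢Γ′ Γ⊆Γ′) (⊢tm-weaken ⊢u ⊢Γ′ Γ⊆Γ′)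

∈ᶜ⇒⊢ty : ∀ {Γ x A} → ⊢ᶜ Γ → (x , A) ∈ᶜ Γ → Γ ⊢ty A
∈ᶜ⇒⊢ty ⊢Γ▸@(⊢▸ ⊢B _) here = ⊢ty-weaken ⊢B ⊢Γ▸ there
∈ᶜ⇒⊢ty ⊢Γ▸@(⊢▸ ⊢B _) (there p) = ⊢ty-weaken (∈ᶜ⇒⊢ty (⊢ty⇒⊢ᶜ ⊢B) p) ⊢Γ▸ there

⊢tm⇒⊢ty : ∀ {Γ t A} → Γ ⊢ t ∶ A → Γ ⊢ty A
⊢tm⇒⊢ty (⊢var ⊢Γ p) = ∈ᶜ⇒⊢ty ⊢Γ p
⊢tm⇒⊢ty (⊢op {Θ} {k = k} _ _ ⊢t ⊢u _ _ ⊢γ) =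
  ⊢Hom (⊢[]tm ⊢t (⊢ₛ⇒⊢ᶜ ⊢γ) (⊢ₛ⇒⊢ᵛ ⊢γ ∘ ∂⁻-⊆ᶜ k Θ))
       (⊢[]tm ⊢u (⊢ₛ⇒⊢ᶜ ⊢γ) (⊢ₛ⇒⊢ᵛ ⊢γ ∘ ∂⁺-⊆ᶜ k Θ))
⊢tm⇒⊢ty (⊢coh _ ⊢t ⊢u _ _ ⊢γ) =
  ⊢Hom (⊢[]tm ⊢t (⊢ₛ⇒⊢ᶜ ⊢γ) (⊢ₛ⇒⊢ᵛ ⊢γ)) (⊢[]tm ⊢u (⊢ₛ⇒⊢ᶜ ⊢γ) (⊢ₛ⇒⊢ᵛ ⊢γ))

lookupM-here : ∀ M x A → lookupM (M ▸ᵐ x ∶ A) x ≡ just A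
lookupM-here M x A with x ≟ x
... | yes _ = refl
... | no x≢x = ⊥-elim (x≢x refl)

lookupM-there : ∀ M {x y} A → x ≢ y → lookupM (M ▸ᵐ y ∶ A) x ≡ lookupM M x
lookupM-there M {x} {y} A x≢y with x ≟ y
... | yes x≡y = ⊥-elim (x≢y x≡y)
... | no _ = refl

_⊇ᴰ_ : MCtx → Ctx → Set
M ⊇ᴰ Γ = ∀ {x A} → (x , A) ∈ᶜ Γ → lookupM M x ≡ just (D-ty A)

D-ctx-⊇ᴰ : ∀ {Γ} → ⊢ᶜ Γ → D-ctx Γ ⊇ᴰ Γ
D-ctx-⊇ᴰ {Γ ▸ x ∶ A} _ here = lookupM-here (D-ctx Γ) x (D-ty A)
D-ctx-⊇ᴰ {Γ ▸ y ∶ B} ⊢Γ▸@(⊢▸ ⊢B _) (there p) =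
  trans (lookupM-there (D-ctx Γ) (D-ty B) (⊢ᶜ▸⇒≢ ⊢Γ▸ (∈ᶜ⇒∈names p)))
        (D-ctx-⊇ᴰ (⊢ty⇒⊢ᶜ ⊢B) p)

names≤maxName : ∀ Γ {x} → x ∈ names Γ → x ≤ maxName (D-ctx Γ)
names≤maxName (Γ ▸ y ∶ A) m with ∈-++[x]⁻ (names Γ) m
... | inj₁ q = ≤-trans (names≤maxName Γ q) (m≤m⊔n (maxName (D-ctx Γ)) y)
... | inj₂ refl = m≤n⊔m (maxName (D-ctx Γ)) y

fresh-D-ctx∉ : ∀ Γ → fresh (D-ctx Γ) ∉ names Γ
fresh-D-ctx∉ Γ = 1+n≰n ∘ names≤maxName Γ

Σr-var-𝟙 : ∀ b M {x} → lookupM M x ≡ just 𝟙 → Σr-var b M x ≡ var b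
Σr-var-𝟙 b M eq rewrite eq = refl

Σr-var-MHom : ∀ b M {x A s u} → lookupM M x ≡ just (MHom A s u) → Σr-var b M x ≡ var x
Σr-var-MHom b M eq rewrite eq = refl

lookupS-Σr-sub-fresh : ∀ b M N γ → fresh N ∉ dom γ →
  lookupS (Σr-sub b M N (D-sub γ)) (fresh N) ≡ just (var b)
lookupS-Σr-sub-fresh b M N ⟨⟩ _ = lookupS-here ⟨⟩ (fresh N) (var b)
lookupS-Σr-sub-fresh b M N (γ ▸ x ↦ t) c∉ with isUnitTy (lookupM N x)
... | true = lookupS-Σr-sub-fresh b M N γ (c∉ ∘ xs⊆xs++ys _ _)
... | false =
  trans (lookupS-there (Σr-sub b M N (D-sub γ)) {y = x} (Σr-tm b M (D-tm t))
                       (λ { refl → c∉ (x∈xs++[x] (dom γ)) }))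
        (lookupS-Σr-sub-fresh b M N γ (c∉ ∘ xs⊆xs++ys _ _))

lookupS-Σr-sub-MHom : ∀ b M N γ {x A s u} → lookupM N x ≡ just (MHom A s u) → x ≢ fresh N →
  lookupS (Σr-sub b M N (D-sub γ)) x ≡ Maybe.map (Σr-tm b M ∘ D-tm) (lookupS γ x)
lookupS-Σr-sub-MHom b M N ⟨⟩ _ x≢c = lookupS-there ⟨⟩ (var b) x≢c
lookupS-Σr-sub-MHom b M N (γ ▸ y ↦ t) {x} Nx x≢c with x ≟ y
... | yes refl rewrite Nx = lookupS-here _ x _
... | no x≢y with isUnitTy (lookupM N y)
...   | true = lookupS-Σr-sub-MHom b M N γ Nx x≢c
...   | false = trans (lookupS-there (Σr-sub b M N (D-sub γ)) (Σr-tm b M (D-tm t)) x≢y)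
                      (lookupS-Σr-sub-MHom b M N γ Nx x≢c)

var-[]-bulletAux : ∀ {b M} Γ {y} → y ∈ names Γ → var y [ bulletAux b M Γ ]tm ≡ Σr-var b M y
var-[]-bulletAux (Γ ▸ z ∶ A) {y} m with y ≟ z
... | yes refl = refl
... | no y≢z = [ var-[]-bulletAux Γ , ⊥-elim ∘ y≢z ]′ (∈-++[x]⁻ (names Γ) m)

-- Terms of type ⋆ are variables, since op and coh only produce Hom-types.
[]tm-bulletAux-⋆ : ∀ {Δ t b M} → M ⊇ᴰ Δ → Δ ⊢ t ∶ ⋆ → t [ bulletAux b M Δ ]tm ≡ var b
[]tm-bulletAux-⋆ {Δ} {b = b} {M} M⊇Δ (⊢var _ p) =
  trans (var-[]-bulletAux Δ (∈ᶜ⇒∈names p)) (Σr-var-𝟙 b M (M⊇Δ p))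

mutual
  []tm-bulletAux : ∀ {Γ t A b M} → M ⊇ᴰ Γ → Γ ⊢ t ∶ A →
    t [ bulletAux b M Γ ]tm ≡ Σr-tm b M (D-tm t)
  []tm-bulletAux {Γ} _ (⊢var _ p) = var-[]-bulletAux Γ (∈ᶜ⇒∈names p)
  []tm-bulletAux M⊇Γ (⊢op {Θ} {A = A} {t} {u} _ _ _ _ _ _ ⊢γ) =
    cong (op Θ (Hom A t u)) (∘ₛ-bulletAux-natural M⊇Γ ⊢γ)
  []tm-bulletAux M⊇Γ (⊢coh {Θ} {A = A} {t} {u} _ _ _ _ _ ⊢γ) =
    cong (coh Θ (Hom A t u)) (∘ₛ-bulletAux-natural M⊇Γ ⊢γ)

  ∘ₛ-bulletAux-natural : ∀ {Δ γ Θ b M} → M ⊇ᴰ Δ → Δ ⊢ₛ γ ∶ Θ →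
    γ ∘ₛ bulletAux b M Δ ≡ bullet Θ ∘ₛ Σr-sub b M (D-ctx Θ) (D-sub γ)
  ∘ₛ-bulletAux-natural {γ = γ} {Θ} {b} {M} M⊇Δ ⊢γ =
    ∘ₛ-bulletAux-factor M⊇Δ ⊢γ (D-ctx-⊇ᴰ ⊢Θ)
      (lookupS-Σr-sub-fresh b M (D-ctx Θ) γ c∉γ)
      (λ p → lookupS-Σr-sub-MHom b M (D-ctx Θ) γ (D-ctx-⊇ᴰ ⊢Θ p)
               (λ { refl → c∉γ (names⊆dom ⊢γ (∈ᶜ⇒∈names p)) }))
    where
      ⊢Θ = ⊢ₛ⇒⊢ᶜ-cod ⊢γ
      c∉γ : fresh (D-ctx Θ) ∉ dom γ
      c∉γ = fresh-D-ctx∉ Θ ∘ subst (_ ∈_) (dom-⊢ₛ ⊢γ)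

  ∘ₛ-bulletAux-factor : ∀ {Δ γ Θ b M c N S} → M ⊇ᴰ Δ → Δ ⊢ₛ γ ∶ Θ → N ⊇ᴰ Θ →
    lookupS S c ≡ just (var b) →
    (∀ {x A s u} → (x , Hom A s u) ∈ᶜ Θ →
      lookupS S x ≡ Maybe.map (Σr-tm b M ∘ D-tm) (lookupS γ x)) →
    γ ∘ₛ bulletAux b M Δ ≡ bulletAux c N Θ ∘ₛ S
  ∘ₛ-bulletAux-factor _ (⊢⟨⟩ _) _ _ _ = refl
  ∘ₛ-bulletAux-factor {Δ} {b = b} {M} {c} {N} {S} M⊇Δ
      (⊢▸ₛ {γ = γ} {x = x} {A = A} {t = t} ⊢γ ⊢Θ▸ ⊢t) N⊇Θ Sc SHom =
    cong₂ (_▸ x ↦_)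
      (∘ₛ-bulletAux-factor M⊇Δ ⊢γ (N⊇Θ ∘ there) Sc
        (λ p → trans (SHom (there p))
                     (cong (Maybe.map _) (lookupS-there γ t (⊢ᶜ▸⇒≢ ⊢Θ▸ (∈ᶜ⇒∈names p))))))
      (last-entries-agree A ⊢t (N⊇Θ here) (λ { refl → SHom here }))
    where
      last-entries-agree : ∀ A → Δ ⊢ t ∶ (A [ γ ]ty) → lookupM N x ≡ just (D-ty A) →
        (∀ {B s u} → A ≡ Hom B s u →
          lookupS S x ≡ Maybe.map (Σr-tm b M ∘ D-tm) (lookupS (γ ▸ x ↦ t) x)) →
        t [ bulletAux b M Δ ]tm ≡ Σr-var c N x [ S ]tm
      last-entries-agree ⋆ ⊢t Nx _ rewrite Nx | Sc = []tm-bulletAux-⋆ M⊇Δ ⊢t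
      last-entries-agree (Hom B s u) ⊢t Nx Sx rewrite Nx | Sx refl | lookupS-here γ x t =
        []tm-bulletAux M⊇Δ ⊢t

[]ty-bulletAux : ∀ {Γ A b M} → M ⊇ᴰ Γ → Γ ⊢ty A →
  A [ bulletAux b M Γ ]ty ≡ Σr-ty b M (D-ty A)
[]ty-bulletAux _ (⊢⋆ _) = refl
[]ty-bulletAux M⊇Γ (⊢Hom ⊢t ⊢u) =
  cong₃ Hom ([]ty-bulletAux M⊇Γ (⊢tm⇒⊢ty ⊢t)) ([]tm-bulletAux M⊇Γ ⊢t)
            ([]tm-bulletAux M⊇Γ ⊢u)

•∈Σr-ctxAux : ∀ b M X → (b , ⋆) ∈ᶜ Σr-ctxAux b M X
•∈Σr-ctxAux b M ∅ᵐ = here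
•∈Σr-ctxAux b M (X ▸ᵐ _ ∶ 𝟙) = •∈Σr-ctxAux b M X
•∈Σr-ctxAux b M (X ▸ᵐ _ ∶ MHom _ _ _) = there (•∈Σr-ctxAux b M X)

names-Σr-ctxAux : ∀ b M Γ → names (Σr-ctxAux b M (D-ctx Γ)) ⊆ b ∷ names Γ
names-Σr-ctxAux b M ∅ = λ m → m
names-Σr-ctxAux b M (Γ ▸ _ ∶ ⋆) = ∷⁺ʳ b (xs⊆xs++ys (names Γ) _) ∘ names-Σr-ctxAux b M Γ
names-Σr-ctxAux b M (Γ ▸ x ∶ Hom _ _ _) =
  ++-⊆ (∷⁺ʳ b (xs⊆xs++ys (names Γ) _) ∘ names-Σr-ctxAux b M Γ)
       (λ { (∈-here refl) → ∈-there (x∈xs++[x] (names Γ)) })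

⊢bulletAux : ∀ {Γ b M} → ⊢ᶜ Γ → M ⊇ᴰ Γ → b ∉ names Γ →
  Σr-ctxAux b M (D-ctx Γ) ⊢ₛ bulletAux b M Γ ∶ Γ
⊢bulletAux ⊢∅ _ _ = ⊢⟨⟩ (⊢▸ (⊢⋆ ⊢∅) λ ())
⊢bulletAux {Γ ▸ x ∶ ⋆} {b} {M} ⊢Γ▸@(⊢▸ ⊢⋆Γ _) M⊇Γ▸ b∉ =
  ⊢▸ₛ ⊢• ⊢Γ▸
    (subst (Σr-ctxAux b M (D-ctx Γ) ⊢_∶ ⋆) (sym (Σr-var-𝟙 b M (M⊇Γ▸ here)))
      (⊢var (⊢ₛ⇒⊢ᶜ ⊢•) (•∈Σr-ctxAux b M (D-ctx Γ))))
  where ⊢• = ⊢bulletAux (⊢ty⇒⊢ᶜ ⊢⋆Γ) (M⊇Γ▸ ∘ there) (b∉ ∘ xs⊆xs++ys (names Γ) _)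
⊢bulletAux {Γ ▸ x ∶ Hom A s u} {b} {M} ⊢Γ▸@(⊢▸ ⊢A x∉Γ) M⊇Γ▸ b∉ =
  ⊢▸ₛ (⊢ₛ-weaken ⊢• ⊢Σ▸ there) ⊢Γ▸
    (subst₂ (Σ▸ ⊢_∶_) (sym (Σr-var-MHom b M (M⊇Γ▸ here))) (sym Hom[•]) (⊢var ⊢Σ▸ here))
  where
    Σ = Σr-ctxAux b M (D-ctx Γ)
    Σ▸ = Σ ▸ x ∶ Σr-ty b M (D-ty (Hom A s u))
    ⊢• = ⊢bulletAux (⊢ty⇒⊢ᶜ ⊢A) (M⊇Γ▸ ∘ there) (b∉ ∘ xs⊆xs++ys (names Γ) _)
    Hom[•] : Hom A s u [ bulletAux b M Γ ]ty ≡ Σr-ty b M (D-ty (Hom A s u))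
    Hom[•] = []ty-bulletAux (M⊇Γ▸ ∘ there) ⊢A
    x∉Σ : x ∉ names Σ
    x∉Σ m with names-Σr-ctxAux b M Γ m
    ... | ∈-here refl = b∉ (x∈xs++[x] (names Γ))
    ... | ∈-there q = x∉Γ q
    ⊢Σ▸ : ⊢ᶜ Σ▸
    ⊢Σ▸ = ⊢▸ (subst (Σ ⊢ty_) Hom[•] (⊢[]ty ⊢A (⊢ₛ⇒⊢ᶜ ⊢•) (⊢ₛ⇒⊢ᵛ ⊢•))) x∉Σ

mainTheorem16 :
    -- each •_Γ is a morphism Σr (D Γ) → Γ of Syn(CaTT)
    ((Γ : Ctx) → ⊢ᶜ Γ → Σr-ctx (D-ctx Γ) ⊢ₛ bullet Γ ∶ Γ)
    ×
    -- naturality: for every morphism γ : Δ → Γ,  γ ∘ •_Δ = •_Γ ∘ Σr (D γ)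
    ((Γ Δ : Ctx) (γ : Sub) → ⊢ᶜ Γ → Δ ⊢ₛ γ ∶ Γ →
      (γ ∘ₛ bullet Δ) ≡ (bullet Γ ∘ₛ Σr-subst (D-ctx Δ) (D-ctx Γ) (D-sub γ)))
mainTheorem16 =
  (λ Γ ⊢Γ → ⊢bulletAux ⊢Γ (D-ctx-⊇ᴰ ⊢Γ) (fresh-D-ctx∉ Γ)) ,
  (λ _ _ _ _ ⊢γ → ∘ₛ-bulletAux-natural (D-ctx-⊇ᴰ (⊢ₛ⇒⊢ᶜ ⊢γ)) ⊢γ)
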